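{- Let $n\ge 1$, let $\mu,\nu,\lambda\in\mathbb{R}^n$, and let $f\in DC_n(\mu,\nu,\lambda)$. Let $H=\{(x,y,z)\in\mathbb{Z}^3:\ 0\le x,y,z\le n,\ y+z\ge n,\ x+y+z\le 2n\}$, the set of lattice points of the half-octahedron $\mathrm{co}\{XY,XZ,OZ,OY,YZ\}$ with $OY=(0,n,0)$, $OZ=(0,0,n)$, $XY=(n,n,0)$, $XZ=(n,0,n)$, $YZ=(0,n,n)$ (inscribed in the tetrahedron $\{x,y,z\ge0,\ x+y+z\le 2n\}$). Then there exists a function $F:H\to\mathbb{R}$ which is polarized and discretely concave on $H$ such that: (a) on the face $\mathrm{co}\{XY,XZ,YZ\}$ one has $F(i+j,\ n-i,\ n-j)=f(i,j)$ for all integers $i,j\ge 0$ with $i+j\le n$; (b) on the face $\mathrm{co}\{OY,YZ,XY\}$ the function $g(i,j)=F(i,n,j)$ ($i,j\ge0$, $i+j\le n$) belongs to $DC_n(0,\mu,\mu)$ (this set consists of a single function up to an additive constant).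
   Context: $\Delta_n=\{(i,j)\in\mathbb{Z}^2: i,j\ge 0,\ i+j\le n\}$. A function $g$ on a set $S\subseteq\mathbb{Z}^2$ is two-dimensional discretely concave if for all integers $i,j$ with all four points involved in $S$: (i) $g(i,j)+g(i+1,j+1)\le g(i+1,j)+g(i,j+1)$; (ii) $g(i+1,j)+g(i+1,j+1)\ge g(i,j+1)+g(i+2,j)$; (iii) $g(i,j+1)+g(i+1,j+1)\ge g(i,j+2)+g(i+1,j)$. For $\mu,\nu,\lambda\in\mathbb{R}^n$, $DC_n(\mu,\nu,\lambda)$ is the set of discretely concave $g:\Delta_n\to\mathbb{R}$ whose boundary increments are $\mu$ along the left side, $\nu$ along the hypotenuse and $\lambda$ along the base, i.e. for $k=1,\dots,n$: $g(0,k)-g(0,k-1)=\mu_k$, $g(k,n-k)-g(k-1,n-k+1)=\nu_k$, $g(k,0)-g(k-1,0)=\lambda_k$. Here $0$ denotes the zero $n$-tuple. Let $e_1,e_2,e_3$ be the standard basis of $\mathbb{Z}^3$. A unitary octahedron is $\{v+e_1,v+e_2,v+e_3,v+e_1+e_2,v+e_1+e_3,v+e_2+e_3\}$, $v\in\mathbb{Z}^3$, with main diagonal $\{v+e_3,v+e_1+e_2\}$ and other antipodal pairs $\{v+e_1,v+e_2+e_3\}$, $\{v+e_2,v+e_1+e_3\}$. A function $F$ on $H$ is polarized if for every unitary octahedron with all vertices in $H$, $F(v+e_3)+F(v+e_1+e_2)=\max\big(F(v+e_1)+F(v+e_2+e_3),\ F(v+e_2)+F(v+e_1+e_3)\big)$.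 $F$ is discretely concave on $H$ (polymatroidal discretely concave) if for every unitary octahedron in $H$ the maximum of the three antipodal sums is attained at least twice, and all rhombus inequalities hold in all cutting planes: for every integer $c$, the functions $(x,y)\mapsto F(x,y,c)$, $(y,z)\mapsto F(c,y,z)$, $(x,z)\mapsto F(x,c,z)$ and $(x,y)\mapsto F(x,y,c-x-y)$ are two-dimensional discretely concave on the sets of points where they are defined in $H$. -}

module Defs where

open import Level using (0ℓ)
open import Data.Nat as ℕ using (ℕ; zero; suc; _∸_)
open import Data.Fin using (Fin; toℕ)
open import Data.Product using (Σ; ∃; _×_; _,_)
open import Data.Sum using (_⊎_)
open import Relation.Binary.PropositionalEquality using (_≡_)
open import Relation.Nullary using (¬_)

record Reals : Set₁ where
  infixl 6 _+_
  infixl 7 _*_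
  infix 4 _≤_
  field
    R : Set
    0# 1# : R
    _+_ _*_ : R → R → R
    -_ : R → R
    _⁻¹ : R → R
    _≤_ : R → R → Set
    +-assoc : ∀ x y z → (x + y) + z ≡ x + (y + z)
    +-comm : ∀ x y → x + y ≡ y + x
    +-identityʳ : ∀ x → x + 0# ≡ x
    +-inverseʳ : ∀ x → x + (- x) ≡ 0#
    *-assoc : ∀ x y z → (x * y) * z ≡ x * (y * z)
    *-comm : ∀ x y → x * y ≡ y * x
    *-identityʳ : ∀ x → x * 1# ≡ x
    *-inverseʳ : ∀ x → ¬ (x ≡ 0#) → x * (x ⁻¹) ≡ 1#
    distribˡ : ∀ x y z → x * (y + z) ≡ x * y + x * z
    0≢1 : ¬ (0# ≡ 1#)
    ≤-refl : ∀ x → x ≤ x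
    ≤-trans : ∀ {x y z} → x ≤ y → y ≤ z → x ≤ z
    ≤-antisym : ∀ {x y} → x ≤ y → y ≤ x → x ≡ y
    ≤-total : ∀ x y → (x ≤ y) ⊎ (y ≤ x)
    +-mono-≤ : ∀ {x y} z → x ≤ y → x + z ≤ y + z
    *-nonneg : ∀ {x y} → 0# ≤ x → 0# ≤ y → 0# ≤ x * y
    sup : ∀ (P : R → Set) → (∃ λ x → P x) → (∃ λ b → ∀ x → P x → x ≤ b) →
          ∃ λ s → (∀ x → P x → x ≤ s) × (∀ b → (∀ x → P x → x ≤ b) → s ≤ b)

  _-_ : R → R → R
  x - y = x + (- y)

module _ (ℝ : Reals) where
  open Reals ℝ

  IsMax : R → R → R → Set
  IsMax x y z = (y ≤ x) × (z ≤ x) × ((x ≡ y) ⊎ (x ≡ z))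

  -- the maximum of a, b, c is attained at least twice
  MaxTwice : R → R → R → Set
  MaxTwice a b c = ((a ≡ b) × (c ≤ a)) ⊎ (((a ≡ c) × (b ≤ a)) ⊎ ((b ≡ c) × (a ≤ b)))

  -- two-dimensional discrete concavity of g on S ⊆ ℕ² (all points of S have
  -- nonnegative coordinates, so integer i,j with the points in S are naturals)
  DiscConcave2 : (ℕ → ℕ → Set) → (ℕ → ℕ → R) → Set
  DiscConcave2 S g =
    (∀ i j → S i j → S (suc i) (suc j) → S (suc i) j → S i (suc j) →
       g i j + g (suc i) (suc j) ≤ g (suc i) j + g i (suc j))
    × (∀ i j → S (suc i) j → S (suc i) (suc j) → S i (suc j) → S (suc (suc i)) j →
       g i (suc j) + g (suc (suc i)) j ≤ g (suc i) j + g (suc i) (suc j))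
    × (∀ i j → S i (suc j) → S (suc i) (suc j) → S i (suc (suc j)) → S (suc i) j →
       g i (suc (suc j)) + g (suc i) j ≤ g i (suc j) + g (suc i) (suc j))

  InΔ : ℕ → ℕ → ℕ → Set
  InΔ n i j = i ℕ.+ j ℕ.≤ n

  -- DC_n(μ, ν, λ); increments indexed by k = 1..n, stored at Fin index k-1
  DC : (n : ℕ) → (Fin n → R) → (Fin n → R) → (Fin n → R) → (ℕ → ℕ → R) → Set
  DC n μ ν λ' g =
    DiscConcave2 (InΔ n) g
    × (∀ (k : Fin n) → g 0 (suc (toℕ k)) - g 0 (toℕ k) ≡ μ k)
    × (∀ (k : Fin n) → g (suc (toℕ k)) (n ∸ suc (toℕ k)) - g (toℕ k) (n ∸ toℕ k) ≡ ν k)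
    × (∀ (k : Fin n) → g (suc (toℕ k)) 0 - g (toℕ k) 0 ≡ λ' k)

  InH : ℕ → ℕ → ℕ → ℕ → Set
  InH n x y z = (x ℕ.≤ n) × (y ℕ.≤ n) × (z ℕ.≤ n)
                × (n ℕ.≤ y ℕ.+ z) × (x ℕ.+ y ℕ.+ z ℕ.≤ 2 ℕ.* n)

  -- all six vertices of the unitary octahedron based at v = (a,b,c) lie in H
  OctInH : ℕ → ℕ → ℕ → ℕ → Set
  OctInH n a b c =
    InH n (suc a) b c × InH n a (suc b) c × InH n a b (suc c)
    × InH n (suc a) (suc b) c × InH n (suc a) b (suc c) × InH n a (suc b) (suc c)

  Polarized : ℕ → (ℕ → ℕ → ℕ → R) → Set
  Polarized n F = ∀ a b c → OctInH n a b c →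
    IsMax (F a b (suc c) + F (suc a) (suc b) c)
          (F (suc a) b c + F a (suc b) (suc c))
          (F a (suc b) c + F (suc a) b (suc c))

  DiscConcave3 : ℕ → (ℕ → ℕ → ℕ → R) → Set
  DiscConcave3 n F =
    (∀ a b c → OctInH n a b c →
       MaxTwice (F a b (suc c) + F (suc a) (suc b) c)
                (F (suc a) b c + F a (suc b) (suc c))
                (F a (suc b) c + F (suc a) b (suc c)))
    × (∀ c → DiscConcave2 (λ x y → InH n x y c) (λ x y → F x y c))
    × (∀ c → DiscConcave2 (λ y z → InH n c y z) (λ y z → F c y z))
    × (∀ c → DiscConcave2 (λ x z → InH n x c z) (λ x z → F x c z))
    × (∀ c → DiscConcave2 (λ x y → (x ℕ.+ y ℕ.≤ c) × InH n x y (c ∸ (x ℕ.+ y)))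
                          (λ x y → F x y (c ∸ (x ℕ.+ y))))

-- Take F(x, y, z) = G(x, z) + (y − n)σ with σ = f(0, n) − f(1, n − 1), where on the
-- half x + z ≥ n of the square [0, n]² the function G is f transported along
-- (x, z) ↦ (x + z − n, n − z) and corrected by (x + z − n)σ, and below the antidiagonal
-- G(x, z) = f(0, x).  As F is a function of (x, z) plus an affine function of y, the
-- first two antipodal sums of every octahedron coincide and dominate the third exactly
-- when G satisfies its mixed rhombus inequality; so F is polarized, and every plane
-- condition reduces to a rhombus inequality of G or to concavity of G along a line.
-- Away from the antidiagonal these are rhombus inequalities of f; across it the only
-- nontrivial one is f(1, q) + σ ≤ f(0, q + 1), which holds because the rhombus
-- inequalities (iii) along the left side make f(0, q + 1) − f(1, q) antitone in q, and σ
-- is its last value.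
module Submission where

open import Defs
open import Data.Nat using (ℕ; _+_; _∸_; _≤_)
open import Data.Fin using (Fin)
open import Data.Product using (Σ; _×_)
open import Relation.Binary.PropositionalEquality using (_≡_)

open import Level using (0ℓ)
open import Data.Nat using (zero; suc; z≤n; s≤s; _<_)
import Data.Nat.Properties as ℕ
open import Data.Fin using (toℕ)
open import Data.Fin.Properties using (toℕ<n)
open import Data.Product using (_,_; proj₁; proj₂)
open import Data.Sum using (inj₁; inj₂)
open import Relation.Binary.Definitions using (tri<; tri≈; tri>)
open import Relation.Binary.PropositionalEquality
  using (refl; sym; trans; cong; cong₂; subst; isEquivalence; module ≡-Reasoning)
open import Algebra.Bundles using (CommutativeMonoid)
import Algebra.Solver.CommutativeMonoid as CommutativeMonoidSolver
import Algebra.Definitions.RawMonoid as Multiples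
import Algebra.Properties.Monoid.Mult as MultiplesProperties

∸-split : ∀ k {a c} → k + a ≤ c → c ∸ a ≡ k + (c ∸ (k + a))
∸-split k {a} {c} k+a≤c = begin
  c ∸ a              ≡⟨ sym (ℕ.m+[n∸m]≡n (ℕ.m+n≤o⇒m≤o∸n k k+a≤c)) ⟩
  k + (c ∸ a ∸ k)    ≡⟨ cong (k +_) (ℕ.∸-+-assoc c a k) ⟩
  k + (c ∸ (a + k))  ≡⟨ cong (λ s → k + (c ∸ s)) (ℕ.+-comm a k) ⟩
  k + (c ∸ (k + a))  ∎
  where open ≡-Reasoning

+-∸-suc : ∀ {z n} → suc z ≤ n → z + suc (n ∸ suc z) ≡ n
+-∸-suc {z} le = trans (ℕ.+-suc z _) (ℕ.m+[n∸m]≡n le)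

module OrderedGroup (ℝ : Reals) where
  open Reals ℝ public renaming (_+_ to _+ᵣ_; _≤_ to _≤ᵣ_; +-mono-≤ to +-monoˡ-≤)

  +-identityˡ : ∀ x → 0# +ᵣ x ≡ x
  +-identityˡ x = trans (+-comm 0# x) (+-identityʳ x)

  +-commutativeMonoid : CommutativeMonoid 0ℓ 0ℓ
  +-commutativeMonoid = record
    { Carrier = R ; _≈_ = _≡_ ; _∙_ = _+ᵣ_ ; ε = 0#
    ; isCommutativeMonoid = record
      { isMonoid = record
        { isSemigroup = record
          { isMagma = record { isEquivalence = isEquivalence ; ∙-cong = cong₂ _+ᵣ_ }
          ; assoc = +-assoc }
        ; identity = +-identityˡ , +-identityʳ }
      ; comm = +-comm } }

  open CommutativeMonoidSolver +-commutativeMonoid public using (solve; _⊜_; _⊕_)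
  open CommutativeMonoid +-commutativeMonoid using (monoid; rawMonoid)
  open Multiples rawMonoid public using () renaming (_×_ to _·_)
  open MultiplesProperties monoid public using (×-homo-1; ×-homo-+)

  ·-midpoint : ∀ k x → k · x +ᵣ suc (suc k) · x ≡ suc k · x +ᵣ suc k · x
  ·-midpoint k x = solve 2 (λ a x → a ⊕ (x ⊕ (x ⊕ a)) ⊜ (x ⊕ a) ⊕ (x ⊕ a)) refl (k · x) x

  ≤-reflexive : ∀ {x y} → x ≡ y → x ≤ᵣ y
  ≤-reflexive {x} refl = ≤-refl x

  ≤-resp-≡ : ∀ {a b c d} → a ≡ c → b ≡ d → a ≤ᵣ b → c ≤ᵣ d
  ≤-resp-≡ refl refl a≤b = a≤b

  ≤-resp₄ : ∀ {a b c d a′ b′ c′ d′} → a ≡ a′ → b ≡ b′ → c ≡ c′ → d ≡ d′ →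
            a′ +ᵣ b′ ≤ᵣ c′ +ᵣ d′ → a +ᵣ b ≤ᵣ c +ᵣ d
  ≤-resp₄ refl refl refl refl le = le

  +-monoʳ-≤ : ∀ {a b} c → a ≤ᵣ b → c +ᵣ a ≤ᵣ c +ᵣ b
  +-monoʳ-≤ {a} {b} c a≤b = ≤-resp-≡ (+-comm a c) (+-comm b c) (+-monoˡ-≤ c a≤b)

  +-mono-≤ : ∀ {a b c d} → a ≤ᵣ b → c ≤ᵣ d → a +ᵣ c ≤ᵣ b +ᵣ d
  +-mono-≤ {b = b} {c} a≤b c≤d = ≤-trans (+-monoˡ-≤ c a≤b) (+-monoʳ-≤ b c≤d)

  +-cancelʳ-≤ : ∀ {a b} c → a +ᵣ c ≤ᵣ b +ᵣ c → a ≤ᵣ b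
  +-cancelʳ-≤ {a} {b} c le = ≤-resp-≡ (cancel a) (cancel b) (+-monoˡ-≤ (- c) le)
    where
    cancel : ∀ x → (x +ᵣ c) +ᵣ (- c) ≡ x
    cancel x = trans (+-assoc x c (- c)) (trans (cong (x +ᵣ_) (+-inverseʳ c)) (+-identityʳ x))

  +-mono-≤-cancel : ∀ {a b c d l r} k → a ≤ᵣ b → c ≤ᵣ d →
                    a +ᵣ c ≡ l +ᵣ k → b +ᵣ d ≡ r +ᵣ k → l ≤ᵣ r
  +-mono-≤-cancel k a≤b c≤d eqˡ eqʳ = +-cancelʳ-≤ k (≤-resp-≡ eqˡ eqʳ (+-mono-≤ a≤b c≤d))

  pairwise-+-≤ : ∀ {a b c d a′ b′ c′ d′} → a +ᵣ b ≤ᵣ c +ᵣ d → a′ +ᵣ b′ ≡ c′ +ᵣ d′ →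
                 (a +ᵣ a′) +ᵣ (b +ᵣ b′) ≤ᵣ (c +ᵣ c′) +ᵣ (d +ᵣ d′)
  pairwise-+-≤ {a} {b} {c} {d} {a′} {b′} {c′} {d′} le eq =
    ≤-resp-≡ (interchange a b a′ b′) (interchange c d c′ d′) (+-mono-≤ le (≤-reflexive eq))
    where
    interchange : ∀ w x y z → (w +ᵣ x) +ᵣ (y +ᵣ z) ≡ (w +ᵣ y) +ᵣ (x +ᵣ z)
    interchange = solve 4 (λ w x y z → (w ⊕ x) ⊕ (y ⊕ z) ⊜ (w ⊕ y) ⊕ (x ⊕ z)) refl

  gap-antitone : (a b : ℕ → R) (N : ℕ) →
                 (∀ k → k < N → a k +ᵣ b (suc k) ≤ᵣ b k +ᵣ a (suc k)) →
                 ∀ k → k ≤ N → a k +ᵣ b N ≤ᵣ b k +ᵣ a N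
  gap-antitone a b N step k k≤N =
    subst (λ N → a k +ᵣ b N ≤ᵣ b k +ᵣ a N) (ℕ.m∸n+n≡m k≤N) (telescope (N ∸ k) k≤N′)
    where
    k≤N′ : (N ∸ k) + k ≤ N
    k≤N′ = ℕ.≤-reflexive (ℕ.m∸n+n≡m k≤N)
    telescope : ∀ d → d + k ≤ N → a k +ᵣ b (d + k) ≤ᵣ b k +ᵣ a (d + k)
    telescope zero    _  = ≤-reflexive (+-comm (a k) (b k))
    telescope (suc d) le =
      +-mono-≤-cancel (a (d + k) +ᵣ b (d + k)) (telescope d (ℕ.<⇒≤ le)) (step (d + k) le)
        (solve 4 (λ ak bd ad be → (ak ⊕ bd) ⊕ (ad ⊕ be) ⊜ (ak ⊕ be) ⊕ (ad ⊕ bd)) refl _ _ _ _)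
        (solve 4 (λ bk ad bd ae → (bk ⊕ ad) ⊕ (bd ⊕ ae) ⊜ (bk ⊕ ae) ⊕ (ad ⊕ bd)) refl _ _ _ _)

module _ (ℝ : Reals) where
  open OrderedGroup ℝ

  DC-of-function-of-i : ∀ n (φ : ℕ → R) (μ : Fin n → R) (g : ℕ → ℕ → R) →
    (∀ i j → i + j ≤ n → g i j ≡ φ i) →
    (∀ i → suc (suc i) ≤ n → φ i +ᵣ φ (suc (suc i)) ≤ᵣ φ (suc i) +ᵣ φ (suc i)) →
    (∀ (k : Fin n) → φ (suc (toℕ k)) - φ (toℕ k) ≡ μ k) →
    DC ℝ n (λ _ → 0#) μ μ g
  DC-of-function-of-i n φ μ g g≡φ φ-concave φ-increments =
    ( (λ i j s₁ s₂ s₃ s₄ → ≤-resp₄ (g≡φ _ _ s₁) (g≡φ _ _ s₂) (g≡φ _ _ s₃) (g≡φ _ _ s₄)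
                                   (≤-reflexive (+-comm (φ i) (φ (suc i)))))
    , (λ i j s₁ s₂ s₃ s₄ → ≤-resp₄ (g≡φ _ _ s₃) (g≡φ _ _ s₄) (g≡φ _ _ s₁) (g≡φ _ _ s₂)
                                   (φ-concave i (ℕ.m+n≤o⇒m≤o (suc (suc i)) s₄)))
    , (λ i j s₁ s₂ s₃ s₄ → ≤-resp₄ (g≡φ _ _ s₃) (g≡φ _ _ s₄) (g≡φ _ _ s₁) (g≡φ _ _ s₂)
                                   (≤-refl _)) )
    , (λ k → trans (cong₂ _-_ (g≡φ 0 _ (toℕ<n k)) (g≡φ 0 _ (ℕ.<⇒≤ (toℕ<n k))))
                   (+-inverseʳ (φ 0)))
    , (λ k → trans (cong₂ _-_ (g≡φ _ _ (ℕ.≤-reflexive (ℕ.m+[n∸m]≡n (toℕ<n k))))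
                              (g≡φ _ _ (ℕ.≤-reflexive (ℕ.m+[n∸m]≡n (ℕ.<⇒≤ (toℕ<n k))))))
                   (φ-increments k))
    , (λ k → trans (cong₂ _-_ (g≡φ _ 0 (k+1+0≤n k)) (g≡φ _ 0 (ℕ.<⇒≤ (k+1+0≤n k))))
                   (φ-increments k))
    where
    k+1+0≤n : ∀ (k : Fin n) → suc (toℕ k) + 0 ≤ n
    k+1+0≤n k = subst (_≤ n) (sym (ℕ.+-identityʳ _)) (toℕ<n k)

module Construction (ℝ : Reals) (m : ℕ) (f : ℕ → ℕ → Reals.R ℝ)
                    (f-concave : DiscConcave2 ℝ (InΔ ℝ (suc m)) f) where
  open OrderedGroup ℝ

  n : ℕ
  n = suc m

  f-rhombusⁱ : ∀ i j → InΔ ℝ n i j → InΔ ℝ n (suc i) (suc j) → InΔ ℝ n (suc i) j →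
    InΔ ℝ n i (suc j) → f i j +ᵣ f (suc i) (suc j) ≤ᵣ f (suc i) j +ᵣ f i (suc j)
  f-rhombusⁱ = proj₁ f-concave

  f-rhombusⁱⁱ : ∀ i j → InΔ ℝ n (suc i) j → InΔ ℝ n (suc i) (suc j) → InΔ ℝ n i (suc j) →
    InΔ ℝ n (suc (suc i)) j →
    f i (suc j) +ᵣ f (suc (suc i)) j ≤ᵣ f (suc i) j +ᵣ f (suc i) (suc j)
  f-rhombusⁱⁱ = proj₁ (proj₂ f-concave)

  f-rhombusⁱⁱⁱ : ∀ i j → InΔ ℝ n i (suc j) → InΔ ℝ n (suc i) (suc j) → InΔ ℝ n i (suc (suc j)) →
    InΔ ℝ n (suc i) j →
    f i (suc (suc j)) +ᵣ f (suc i) j ≤ᵣ f i (suc j) +ᵣ f (suc i) (suc j)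
  f-rhombusⁱⁱⁱ = proj₂ (proj₂ f-concave)

  f-left-concave : ∀ i → suc (suc i) ≤ n → f 0 i +ᵣ f 0 (suc (suc i)) ≤ᵣ f 0 (suc i) +ᵣ f 0 (suc i)
  f-left-concave i i+2≤n =
    +-mono-≤-cancel (f 1 i +ᵣ f 1 (suc i)) (f-rhombusⁱ 0 i i≤n i+2≤n i+1≤n i+1≤n)
                                          (f-rhombusⁱⁱⁱ 0 i i+1≤n i+2≤n i+2≤n i+1≤n)
      (solve 4 (λ a b c d → (a ⊕ b) ⊕ (c ⊕ d) ⊜ (a ⊕ c) ⊕ (d ⊕ b)) refl _ _ _ _)
      (solve 4 (λ a b c d → (a ⊕ b) ⊕ (c ⊕ d) ⊜ (b ⊕ c) ⊕ (a ⊕ d)) refl _ _ _ _)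
    where
    i+1≤n : suc i ≤ n
    i+1≤n = ℕ.<⇒≤ i+2≤n
    i≤n : i ≤ n
    i≤n = ℕ.<⇒≤ i+1≤n

  σ : R
  σ = f 0 n - f 1 m

  σ-minimal : ∀ q → suc q ≤ n → f 1 q +ᵣ σ ≤ᵣ f 0 (suc q)
  σ-minimal q q<n = ≤-resp-≡ (+-assoc _ _ _) cancel (+-monoˡ-≤ (- f 1 m) gap)
    where
    step : ∀ k → k < m → f 1 k +ᵣ f 0 (suc (suc k)) ≤ᵣ f 0 (suc k) +ᵣ f 1 (suc k)
    step k k<m = ≤-resp-≡ (+-comm _ _) refl
      (f-rhombusⁱⁱⁱ 0 k (ℕ.<⇒≤ (s≤s k<m)) (s≤s k<m) (s≤s k<m) (ℕ.<⇒≤ (s≤s k<m)))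
    gap : f 1 q +ᵣ f 0 n ≤ᵣ f 0 (suc q) +ᵣ f 1 m
    gap = gap-antitone (f 1) (λ k → f 0 (suc k)) m step q (ℕ.≤-pred q<n)
    cancel : (f 0 (suc q) +ᵣ f 1 m) +ᵣ (- f 1 m) ≡ f 0 (suc q)
    cancel = trans (+-assoc _ _ _) (trans (cong (f 0 (suc q) +ᵣ_) (+-inverseʳ _)) (+-identityʳ _))

  G : ℕ → ℕ → R
  G x z = f p (x ∸ p) +ᵣ p · σ
    where
    p : ℕ
    p = x + z ∸ n

  -- Above the antidiagonal, (x , z) stands for the point (p , q) = (x + z − n , n − z) of Δ_n.
  record Upper (x z p q : ℕ) : Set where
    constructor upper
    field
      sum        : x + z ≡ n + p
      complement : z + q ≡ n

  upper-intro : ∀ {x z q} → n ≤ x + z → z + q ≡ n → Upper x z (x + z ∸ n) q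
  upper-intro n≤x+z z+q≡n = upper (sym (ℕ.m+[n∸m]≡n n≤x+z)) z+q≡n

  upper-sucˣ : ∀ {x z p q} → Upper x z p q → Upper (suc x) z (suc p) q
  upper-sucˣ {p = p} (upper sum z+q) = upper (trans (cong suc sum) (sym (ℕ.+-suc n p))) z+q

  upper-sucᶻ : ∀ {x z p q} → Upper x z p (suc q) → Upper x (suc z) (suc p) q
  upper-sucᶻ {x} {z} {p} {q} (upper sum z+q) =
    upper (trans (ℕ.+-suc x z) (trans (cong suc sum) (sym (ℕ.+-suc n p))))
          (trans (sym (ℕ.+-suc z q)) z+q)

  upper-shift : ∀ {x z p q} → Upper x (suc z) p q → Upper (suc x) z p (suc q)
  upper-shift {x} {z} {p} {q} (upper sum z+q) =
    upper (trans (sym (ℕ.+-suc x z)) sum) (trans (ℕ.+-suc z q) z+q)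

  upper-p+q : ∀ {x z p q} → Upper x z p q → p + q ≡ x
  upper-p+q {x} {z} {p} {q} (upper sum z+q) = ℕ.+-cancelʳ-≡ z (p + q) x (begin
    (p + q) + z  ≡⟨ ℕ.+-comm (p + q) z ⟩
    z + (p + q)  ≡⟨ cong (z +_) (ℕ.+-comm p q) ⟩
    z + (q + p)  ≡⟨ sym (ℕ.+-assoc z q p) ⟩
    (z + q) + p  ≡⟨ cong (_+ p) z+q ⟩
    n + p        ≡⟨ sym sum ⟩
    x + z        ∎)
    where open ≡-Reasoning

  upper-inΔ : ∀ {x z p q} → Upper x z p q → x ≤ n → InΔ ℝ n p q
  upper-inΔ u x≤n = subst (_≤ n) (sym (upper-p+q u)) x≤n

  G-upper : ∀ {x z p q} → Upper x z p q → G x z ≡ f p q +ᵣ p · σ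
  G-upper {x} {z} {p} {q} u@(upper sum _) =
    trans (cong (λ p → f p (x ∸ p) +ᵣ p · σ) p≡)
          (cong (λ q → f p q +ᵣ p · σ) (trans (cong (_∸ p) (sym (upper-p+q u))) (ℕ.m+n∸m≡n p q)))
    where
    p≡ : x + z ∸ n ≡ p
    p≡ = trans (cong (_∸ n) sum) (ℕ.m+n∸m≡n n p)

  G-lower : ∀ x z → x + z ≤ n → G x z ≡ f 0 x
  G-lower x z x+z≤n rewrite ℕ.m≤n⇒m∸n≡0 x+z≤n = +-identityʳ (f 0 x)

  G-rhombusⁱ : ∀ a c → suc a ≤ n → suc c ≤ n →
               G a c +ᵣ G (suc a) (suc c) ≤ᵣ G a (suc c) +ᵣ G (suc a) c
  G-rhombusⁱ a c a<n c<n with ℕ.<-cmp (suc (a + c)) n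
  ... | tri< below _ _ =
    ≤-resp₄ (G-lower a c (ℕ.<⇒≤ (ℕ.<⇒≤ below)))
            (G-lower (suc a) (suc c) (subst (λ s → suc s ≤ n) (sym (ℕ.+-suc a c)) below))
            (G-lower a (suc c) (subst (_≤ n) (sym (ℕ.+-suc a c)) (ℕ.<⇒≤ below)))
            (G-lower (suc a) c (ℕ.<⇒≤ below))
            (≤-refl _)
  ... | tri≈ _ edge _ =
    ≤-resp₄ (G-lower a c (subst (a + c ≤_) edge (ℕ.n≤1+n _)))
            (G-upper {suc a} {suc c} {1} {a}
              (upper (trans (cong suc (trans (ℕ.+-suc a c) edge)) (ℕ.+-comm 1 n))
                     (trans (cong suc (ℕ.+-comm c a)) edge)))
            (G-lower a (suc c) (ℕ.≤-reflexive (trans (ℕ.+-suc a c) edge)))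
            (G-lower (suc a) c (ℕ.≤-reflexive edge))
            (+-monoʳ-≤ (f 0 a) (≤-resp-≡ (cong (f 1 a +ᵣ_) (sym (×-homo-1 σ))) refl (σ-minimal a a<n)))
  ... | tri> _ _ above =
    ≤-resp₄ (G-upper u) (G-upper (upper-sucˣ (upper-sucᶻ u)))
            (G-upper (upper-sucᶻ u)) (G-upper (upper-sucˣ u))
            (pairwise-+-≤ (f-rhombusⁱⁱ _ _ (upper-inΔ (upper-sucᶻ u) (ℕ.<⇒≤ a<n))
                                           (upper-inΔ (upper-sucˣ u) a<n)
                                           (upper-inΔ u (ℕ.<⇒≤ a<n))
                                           (upper-inΔ (upper-sucˣ (upper-sucᶻ u)) a<n))
                          (·-midpoint (a + c ∸ n) σ))
    where
    u : Upper a c (a + c ∸ n) (suc (n ∸ suc c))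
    u = upper-intro (ℕ.≤-pred above) (+-∸-suc c<n)

  G-rhombusⁱⁱ : ∀ i j → suc (suc i) ≤ n → suc j ≤ n →
                G i (suc j) +ᵣ G (suc (suc i)) j ≤ᵣ G (suc i) j +ᵣ G (suc i) (suc j)
  G-rhombusⁱⁱ i j i+2≤n j<n with ℕ.≤-<-connex n (i + suc j)
  ... | inj₁ above =
    ≤-resp₄ (G-upper u) (G-upper (upper-sucˣ (upper-shift u)))
            (G-upper (upper-shift u)) (G-upper (upper-sucˣ u))
            (pairwise-+-≤ (≤-resp-≡ refl (+-comm _ _)
                            (f-rhombusⁱ _ _ (upper-inΔ u (ℕ.<⇒≤ i<n))
                                            (upper-inΔ (upper-sucˣ (upper-shift u)) i+2≤n)
                                            (upper-inΔ (upper-sucˣ u) i<n)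
                                            (upper-inΔ (upper-shift u) i<n)))
                          refl)
    where
    i<n : suc i ≤ n
    i<n = ℕ.<⇒≤ i+2≤n
    u : Upper i (suc j) (i + suc j ∸ n) (n ∸ suc j)
    u = upper-intro above (ℕ.m+[n∸m]≡n j<n)
  ... | inj₂ below =
    ≤-resp₄ (G-lower i (suc j) (ℕ.<⇒≤ below))
            (G-lower (suc (suc i)) j (subst (λ s → suc s ≤ n) (ℕ.+-suc i j) below))
            (G-lower (suc i) j (subst (_≤ n) (ℕ.+-suc i j) (ℕ.<⇒≤ below)))
            (G-lower (suc i) (suc j) below)
            (f-left-concave i i+2≤n)

  G-rhombusⁱⁱⁱ : ∀ i j → suc i ≤ n → suc (suc j) ≤ n →
                 G i (suc (suc j)) +ᵣ G (suc i) j ≤ᵣ G i (suc j) +ᵣ G (suc i) (suc j)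
  G-rhombusⁱⁱⁱ i j i<n j+2≤n with ℕ.≤-<-connex n (i + suc j)
  ... | inj₁ above =
    ≤-resp₄ (G-upper (upper-sucᶻ u)) (G-upper (upper-shift u))
            (G-upper u) (G-upper (upper-sucˣ u))
            (pairwise-+-≤ (≤-resp-≡ (+-comm _ _) refl
                            (f-rhombusⁱⁱⁱ _ _ (upper-inΔ u (ℕ.<⇒≤ i<n))
                                              (upper-inΔ (upper-sucˣ u) i<n)
                                              (upper-inΔ (upper-shift u) i<n)
                                              (upper-inΔ (upper-sucᶻ u) (ℕ.<⇒≤ i<n))))
                          (+-comm (suc (i + suc j ∸ n) · σ) ((i + suc j ∸ n) · σ)))
    where
    u : Upper i (suc j) (i + suc j ∸ n) (suc (n ∸ suc (suc j)))
    u = upper-intro above (+-∸-suc j+2≤n)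
  ... | inj₂ below =
    ≤-resp₄ (G-lower i (suc (suc j)) (subst (_≤ n) (sym (ℕ.+-suc i (suc j))) below))
            (G-lower (suc i) j (subst (_≤ n) (ℕ.+-suc i j) (ℕ.<⇒≤ below)))
            (G-lower i (suc j) (ℕ.<⇒≤ below))
            (G-lower (suc i) (suc j) below)
            (≤-refl _)

  G-concaveˣ : ∀ i z → suc (suc i) ≤ n → z ≤ n →
               G i z +ᵣ G (suc (suc i)) z ≤ᵣ G (suc i) z +ᵣ G (suc i) z
  G-concaveˣ i zero i+2≤n _ =
    +-mono-≤-cancel (G (suc i) 1 +ᵣ G i 1)
      (G-rhombusⁱ i 0 (ℕ.<⇒≤ i+2≤n) 1≤n) (G-rhombusⁱⁱ i 0 i+2≤n 1≤n)
      (solve 4 (λ a b c d → (a ⊕ b) ⊕ (c ⊕ d) ⊜ (a ⊕ d) ⊕ (b ⊕ c)) refl _ _ _ _)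
      (solve 3 (λ c e b → (c ⊕ e) ⊕ (e ⊕ b) ⊜ (e ⊕ e) ⊕ (b ⊕ c)) refl _ _ _)
    where
    1≤n : 1 ≤ n
    1≤n = s≤s z≤n
  G-concaveˣ i (suc z) i+2≤n z<n =
    +-mono-≤-cancel (G (suc i) z +ᵣ G (suc (suc i)) z)
      (G-rhombusⁱⁱ i z i+2≤n z<n) (G-rhombusⁱ (suc i) z i+2≤n z<n)
      (solve 4 (λ a b c d → (a ⊕ b) ⊕ (c ⊕ d) ⊜ (a ⊕ d) ⊕ (c ⊕ b)) refl _ _ _ _)
      (solve 3 (λ c e b → (c ⊕ e) ⊕ (e ⊕ b) ⊜ (e ⊕ e) ⊕ (c ⊕ b)) refl _ _ _)

  G-concaveᶻ : ∀ x j → x ≤ n → suc (suc j) ≤ n →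
               G x j +ᵣ G x (suc (suc j)) ≤ᵣ G x (suc j) +ᵣ G x (suc j)
  G-concaveᶻ zero j _ j+2≤n =
    +-mono-≤-cancel (G 1 j +ᵣ G 1 (suc j))
      (G-rhombusⁱⁱⁱ 0 j 1≤n j+2≤n) (G-rhombusⁱ 0 j 1≤n (ℕ.<⇒≤ j+2≤n))
      (solve 4 (λ a b c d → (a ⊕ b) ⊕ (c ⊕ d) ⊜ (c ⊕ a) ⊕ (b ⊕ d)) refl _ _ _ _)
      (solve 3 (λ e d b → (e ⊕ d) ⊕ (e ⊕ b) ⊜ (e ⊕ e) ⊕ (b ⊕ d)) refl _ _ _)
    where
    1≤n : 1 ≤ n
    1≤n = s≤s z≤n
  G-concaveᶻ (suc x) j x<n j+2≤n =
    +-mono-≤-cancel (G x (suc (suc j)) +ᵣ G x (suc j))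
      (G-rhombusⁱⁱⁱ x j x<n j+2≤n) (G-rhombusⁱ x (suc j) x<n j+2≤n)
      (solve 4 (λ a b c d → (a ⊕ b) ⊕ (c ⊕ d) ⊜ (b ⊕ d) ⊕ (a ⊕ c)) refl _ _ _ _)
      (solve 3 (λ c e a → (c ⊕ e) ⊕ (a ⊕ e) ⊜ (e ⊕ e) ⊕ (a ⊕ c)) refl _ _ _)

  T : ℕ → R
  T y = y · σ +ᵣ - (n · σ)

  T-midpoint : ∀ j → T j +ᵣ T (suc (suc j)) ≡ T (suc j) +ᵣ T (suc j)
  T-midpoint j = solve 3 (λ a s c → (a ⊕ c) ⊕ ((s ⊕ (s ⊕ a)) ⊕ c) ⊜ ((s ⊕ a) ⊕ c) ⊕ ((s ⊕ a) ⊕ c))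
                         refl (j · σ) σ (- (n · σ))

  T-top : T n ≡ 0#
  T-top = +-inverseʳ (n · σ)

  T-complement : ∀ i → i ≤ n → i · σ +ᵣ T (n ∸ i) ≡ 0#
  T-complement i i≤n = begin
    i · σ +ᵣ ((n ∸ i) · σ +ᵣ - (n · σ))   ≡⟨ sym (+-assoc _ _ _) ⟩
    (i · σ +ᵣ (n ∸ i) · σ) +ᵣ - (n · σ)   ≡⟨ cong (_+ᵣ - (n · σ)) (sym (×-homo-+ σ i (n ∸ i))) ⟩
    (i + (n ∸ i)) · σ +ᵣ - (n · σ)        ≡⟨ cong (λ k → k · σ +ᵣ - (n · σ)) (ℕ.m+[n∸m]≡n i≤n) ⟩
    n · σ +ᵣ - (n · σ)                    ≡⟨ +-inverseʳ (n · σ) ⟩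
    0#                                    ∎
    where open ≡-Reasoning

  F : ℕ → ℕ → ℕ → R
  F x y z = G x z +ᵣ T y

  octahedron : ∀ a b c → suc a ≤ n → suc c ≤ n →
    (F a b (suc c) +ᵣ F (suc a) (suc b) c ≡ F (suc a) b c +ᵣ F a (suc b) (suc c))
    × (F a (suc b) c +ᵣ F (suc a) b (suc c) ≤ᵣ F a b (suc c) +ᵣ F (suc a) (suc b) c)
  octahedron a b c a<n c<n =
    solve 4 (λ g t h s → (g ⊕ t) ⊕ (h ⊕ s) ⊜ (h ⊕ t) ⊕ (g ⊕ s)) refl _ _ _ _ ,
    pairwise-+-≤ (G-rhombusⁱ a c a<n c<n) (+-comm (T (suc b)) (T b))

  x-bound : ∀ {x y z} → InH ℝ n x y z → x ≤ n
  x-bound = proj₁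

  z-bound : ∀ {x y z} → InH ℝ n x y z → z ≤ n
  z-bound s = proj₁ (proj₂ (proj₂ s))

  F-polarized : Polarized ℝ n F
  F-polarized a b c (s₁ , _ , s₃ , _)
    with octahedron a b c (x-bound s₁) (z-bound s₃)
  ... | S₁≡S₂ , S₃≤S₁ = ≤-reflexive (sym S₁≡S₂) , S₃≤S₁ , inj₁ S₁≡S₂

  F-concave-z : ∀ c → DiscConcave2 ℝ (λ x y → InH ℝ n x y c) (λ x y → F x y c)
  F-concave-z c =
    (λ i j _ _ _ _ → pairwise-+-≤ (≤-reflexive (+-comm _ _)) refl) ,
    (λ i j _ _ _ s₄ → pairwise-+-≤ (G-concaveˣ i c (x-bound s₄) (z-bound s₄)) (+-comm _ _)) ,
    (λ i j _ _ _ _ → pairwise-+-≤ (≤-refl _) (trans (+-comm _ _) (T-midpoint j)))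

  F-concave-x : ∀ c → DiscConcave2 ℝ (λ y z → InH ℝ n c y z) (λ y z → F c y z)
  F-concave-x c =
    (λ i j _ _ _ _ → pairwise-+-≤ (≤-refl _) (+-comm _ _)) ,
    (λ i j _ _ _ _ → pairwise-+-≤ (≤-reflexive (+-comm _ _)) (T-midpoint i)) ,
    (λ i j _ _ s₃ _ → pairwise-+-≤ (≤-resp-≡ (+-comm _ _) refl (G-concaveᶻ c j (x-bound s₃) (z-bound s₃)))
                                    refl)

  F-concave-y : ∀ c → DiscConcave2 ℝ (λ x z → InH ℝ n x c z) (λ x z → F x c z)
  F-concave-y c =
    (λ i j _ _ s₃ s₄ → pairwise-+-≤ (≤-resp-≡ refl (+-comm _ _) (G-rhombusⁱ i j (x-bound s₃) (z-bound s₄)))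
                                    refl) ,
    (λ i j _ _ s₃ s₄ → pairwise-+-≤ (G-rhombusⁱⁱ i j (x-bound s₄) (z-bound s₃)) refl) ,
    (λ i j _ _ s₃ s₄ → pairwise-+-≤ (G-rhombusⁱⁱⁱ i j (x-bound s₄) (z-bound s₃)) refl)

  -- The values of z = c ∸ (x + y) at the points of a rhombus of the plane x + y + z = c
  -- based at (i , j).
  module SlantedDepths (c i j : ℕ) (i+j+2≤c : suc (suc (i + j)) ≤ c) where
    u : ℕ
    u = c ∸ suc (suc (i + j))

    depth₀ : c ∸ (i + j) ≡ suc (suc u)
    depth₀ = ∸-split 2 i+j+2≤c

    depth₁ : c ∸ (suc i + j) ≡ suc u
    depth₁ = ∸-split 1 i+j+2≤c

    depth₁′ : c ∸ (i + suc j) ≡ suc u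
    depth₁′ = trans (cong (c ∸_) (ℕ.+-suc i j)) depth₁

    depth₂ : c ∸ (suc i + suc j) ≡ u
    depth₂ = cong (λ s → c ∸ suc s) (ℕ.+-suc i j)

    depth₂′ : c ∸ (i + suc (suc j)) ≡ u
    depth₂′ = cong (c ∸_) (trans (ℕ.+-suc i (suc j)) (cong suc (ℕ.+-suc i j)))

  F-concave-slanted : ∀ c → DiscConcave2 ℝ (λ x y → (x + y ≤ c) × InH ℝ n x y (c ∸ (x + y)))
                                           (λ x y → F x y (c ∸ (x + y)))
  F-concave-slanted c =
    (λ { i j (_ , s₁) (le , _) (_ , s₃) _ →
      let open SlantedDepths c i j (subst (λ s → suc s ≤ c) (ℕ.+-suc i j) le) in
      ≤-resp₄ (cong (F i j) depth₀) (cong (F (suc i) (suc j)) depth₂)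
              (cong (F (suc i) j) depth₁) (cong (F i (suc j)) depth₁′)
              (pairwise-+-≤ (≤-resp-≡ refl (+-comm _ _)
                              (G-rhombusⁱⁱⁱ i u (x-bound s₃) (subst (_≤ n) depth₀ (z-bound s₁))))
                            refl) }) ,
    (λ { i j _ _ (_ , s₃) (le , s₄) →
      let open SlantedDepths c i j le in
      ≤-resp₄ (cong (F i (suc j)) depth₁′) refl
              (cong (F (suc i) j) depth₁) (cong (F (suc i) (suc j)) depth₂)
              (pairwise-+-≤ (≤-resp-≡ refl (+-comm _ _)
                              (G-rhombusⁱⁱ i u (x-bound s₄) (subst (_≤ n) depth₁′ (z-bound s₃))))
                            (+-comm _ _)) }) ,
    (λ { i j (_ , s₁) _ (le , _) (_ , s₄) →
      let open SlantedDepths c i j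
                 (subst (_≤ c) (trans (ℕ.+-suc i (suc j)) (cong suc (ℕ.+-suc i j))) le) in
      ≤-resp₄ (cong (F i (suc (suc j))) depth₂′) (cong (F (suc i) j) depth₁)
              (cong (F i (suc j)) depth₁′) (cong (F (suc i) (suc j)) depth₂)
              (pairwise-+-≤ (G-rhombusⁱ i u (x-bound s₄) (subst (_≤ n) depth₁′ (z-bound s₁)))
                            (trans (+-comm _ _) (T-midpoint j))) })

  F-concave : DiscConcave3 ℝ n F
  F-concave =
    (λ { a b c (s₁ , _ , s₃ , _) → inj₁ (octahedron a b c (x-bound s₁) (z-bound s₃)) }) ,
    F-concave-z , F-concave-x , F-concave-y , F-concave-slanted

  F-hypotenuse-face : ∀ i j → i + j ≤ n → F (i + j) (n ∸ i) (n ∸ j) ≡ f i j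
  F-hypotenuse-face i j i+j≤n = begin
    G (i + j) (n ∸ j) +ᵣ T (n ∸ i)    ≡⟨ cong (_+ᵣ T (n ∸ i)) (G-upper (upper sum (ℕ.m∸n+n≡m j≤n))) ⟩
    (f i j +ᵣ i · σ) +ᵣ T (n ∸ i)     ≡⟨ +-assoc _ _ _ ⟩
    f i j +ᵣ (i · σ +ᵣ T (n ∸ i))     ≡⟨ cong (f i j +ᵣ_) (T-complement i (ℕ.m+n≤o⇒m≤o i i+j≤n)) ⟩
    f i j +ᵣ 0#                       ≡⟨ +-identityʳ (f i j) ⟩
    f i j                             ∎
    where
    open ≡-Reasoning
    j≤n : j ≤ n
    j≤n = ℕ.m+n≤o⇒n≤o i i+j≤n
    sum : (i + j) + (n ∸ j) ≡ n + i
    sum = trans (ℕ.+-assoc i j _) (trans (cong (i +_) (ℕ.m+[n∸m]≡n j≤n)) (ℕ.+-comm i n))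

  F-top-face : ∀ i j → i + j ≤ n → F i n j ≡ f 0 i
  F-top-face i j i+j≤n = trans (cong₂ _+ᵣ_ (G-lower i j i+j≤n) T-top) (+-identityʳ (f 0 i))

mainTheorem3 : (ℝ : Reals) → (n : ℕ) → 1 ≤ n →
    (μ ν λ' : Fin n → Reals.R ℝ) → (f : ℕ → ℕ → Reals.R ℝ) → DC ℝ n μ ν λ' f →
    Σ (ℕ → ℕ → ℕ → Reals.R ℝ) (λ F →
      Polarized ℝ n F × DiscConcave3 ℝ n F
      × (∀ i j → i + j ≤ n → F (i + j) (n ∸ i) (n ∸ j) ≡ f i j)
      × DC ℝ n (λ _ → Reals.0# ℝ) μ μ (λ i j → F i n j))
mainTheorem3 ℝ (suc m) (s≤s z≤n) μ _ _ f (f-concave , μ-increments , _ , _) =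
  F , F-polarized , F-concave , F-hypotenuse-face ,
  DC-of-function-of-i ℝ n (f 0) μ (λ i j → F i n j) F-top-face f-left-concave μ-increments
  where open Construction ℝ m f f-concave
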